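{- Let $a,b$ be positive integers, let $\{F_n(q)\}_{n\geq 0}$ be the $q$-biperiodic Fibonacci sequence and, for $s\geq 0$, let $\{F^{(s)}_n(q)\}_{n\geq 0}$ be the shifted $q$-biperiodic Fibonacci sequence. For every integer $n\geq 0$, $$F_{2n}(q)=\sum_{k=1}^n a^{\xi(k)}q^{(n-k)^2} {n\brack k}(ab)^{\left\lfloor \frac k2 \right\rfloor} F_{k}^{(2n-k)}(q).$$
   Context: Fix positive integers $a,b$; $q$ is an indeterminate. For an integer $n$, $\xi(n)=n-2\lfloor n/2\rfloor$ (so $\xi(n)=0$ if $n$ is even and $1$ if $n$ is odd). The $q$-biperiodic Fibonacci sequence is defined by $F_0(q)=0$, $F_1(q)=1$ and, for $n\geq 2$, $F_n(q)=aF_{n-1}(q)+q^{n-2}F_{n-2}(q)$ if $n$ is even, $F_n(q)=bF_{n-1}(q)+q^{n-2}F_{n-2}(q)$ if $n$ is odd. For an integer $s\geq 0$, the shifted $q$-biperiodic Fibonacci sequence is defined by $F^{(s)}_0(q)=0$, $F^{(s)}_1(q)=1$ and, for $n\geq 2$, $$F^{(s)}_{n}(q)=\begin{cases} a^{\xi(s+1)}b^{1-\xi(s+1)}F^{(s)}_{n-1}(q) + q^{n-2+s}F^{(s)}_{n-2}(q), & n \text{ even},\\ a^{1-\xi(s+1)}b^{\xi(s+1)}F^{(s)}_{n-1}(q) + q^{n-2+s}F^{(s)}_{n-2}(q), & n\text{ odd}.\end{cases}$$ The $q$-binomial coefficient is ${n\brack k}=\frac{[n]_q!}{[k]_q!\,[n-k]_q!}$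 for $0\leq k\leq n$, where $[n]_q=1+q+\cdots+q^{n-1}$ and $[n]_q!=[1]_q[2]_q\cdots[n]_q$, $[0]_q!=1$. Empty sums are $0$. -}

module Defs where

open import Algebra.Bundles using (RawSemiring)
import Algebra.Definitions.RawSemiring as RawSemiringDefinitions
open import Data.Integer.Base as ℤ using (ℤ; +_; 0ℤ; 1ℤ)
import Data.Integer.Properties as ℤ
open import Data.List.Base using (List; []; _∷_; map; replicate)
open import Data.Nat.Base using (ℕ; zero; suc; _+_; _*_; _∸_; _^_; ⌊_/2⌋; parity)
open import Data.Parity.Base using (0ℙ; 1ℙ)
open import Data.Sum.Base using (_⊎_; inj₁; inj₂; [_,_]′)
open import Level using (0ℓ)
open import Relation.Binary.PropositionalEquality
  using (_≡_; refl; sym; trans; cong)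
open import Relation.Nullary using (¬_; yes; no; contradiction)

infix  0 ifEven_then_else_
infix  4 _≈_ _≃_
infixl 6 _+ₚ_ _+ᶠ_
infixl 7 _·ₚ_ _*ₚ_ _*ᶠ_

------------------------------------------------------------------------
-- The polynomial ring ℤ[q]

-- Coefficient lists, constant term first.  Trailing zeros are allowed, so
-- equality of polynomials is _≈_ rather than _≡_.
Poly : Set
Poly = List ℤ

coeff : Poly → ℕ → ℤ
coeff []      _       = 0ℤ
coeff (x ∷ p) zero    = x
coeff (x ∷ p) (suc n) = coeff p n

record _≈_ (p r : Poly) : Set where
  constructor mk≈
  field
    coeff-≡ : ∀ n → coeff p n ≡ coeff r n

open _≈_ public

0ₚ 1ₚ q : Poly
0ₚ = []
1ₚ = 1ℤ ∷ []
q  = 0ℤ ∷ 1ℤ ∷ []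

const : ℕ → Poly
const n = + n ∷ []

_+ₚ_ : Poly → Poly → Poly
[]      +ₚ r       = r
(x ∷ p) +ₚ []      = x ∷ p
(x ∷ p) +ₚ (y ∷ r) = (x ℤ.+ y) ∷ (p +ₚ r)

_·ₚ_ : ℤ → Poly → Poly
x ·ₚ p = map (x ℤ.*_) p

_*ₚ_ : Poly → Poly → Poly
[]      *ₚ r = []
(x ∷ p) *ₚ r = x ·ₚ r +ₚ (0ℤ ∷ p *ₚ r)

polyRawSemiring : RawSemiring 0ℓ 0ℓ
polyRawSemiring = record
  { Carrier = Poly
  ; _≈_     = _≈_
  ; _+_     = _+ₚ_
  ; _*_     = _*ₚ_
  ; 0#      = 0ₚ
  ; 1#      = 1ₚ
  }

open RawSemiringDefinitions polyRawSemiring public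
  using () renaming (_^_ to _^ₚ_)

-- ℤ[q] has no zero divisors

coeff-+ₚ : ∀ p r n → coeff (p +ₚ r) n ≡ coeff p n ℤ.+ coeff r n
coeff-+ₚ []      r       n       = sym (ℤ.+-identityˡ (coeff r n))
coeff-+ₚ (x ∷ p) []      n       = sym (ℤ.+-identityʳ (coeff (x ∷ p) n))
coeff-+ₚ (x ∷ p) (y ∷ r) zero    = refl
coeff-+ₚ (x ∷ p) (y ∷ r) (suc n) = coeff-+ₚ p r n

coeff-·ₚ : ∀ x p n → coeff (x ·ₚ p) n ≡ x ℤ.* coeff p n
coeff-·ₚ x []      n       = sym (ℤ.*-zeroʳ x)
coeff-·ₚ x (y ∷ p) zero    = refl
coeff-·ₚ x (y ∷ p) (suc n) = coeff-·ₚ x p n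

coeff-∷-*ₚ : ∀ x p r n →
  coeff ((x ∷ p) *ₚ r) n ≡ x ℤ.* coeff r n ℤ.+ coeff (0ℤ ∷ p *ₚ r) n
coeff-∷-*ₚ x p r n =
  trans (coeff-+ₚ (x ·ₚ r) (0ℤ ∷ p *ₚ r) n)
        (cong (ℤ._+ coeff (0ℤ ∷ p *ₚ r) n) (coeff-·ₚ x r n))

coeff-*ₚ-0∷ : ∀ p r n → coeff (p *ₚ (0ℤ ∷ r)) (suc n) ≡ coeff (p *ₚ r) n
coeff-*ₚ-0∷ []      r n = refl
coeff-*ₚ-0∷ (x ∷ p) r n =
  trans (coeff-∷-*ₚ x p (0ℤ ∷ r) (suc n))
        (trans (cong (ℤ._+_ (x ℤ.* coeff r n)) (lemma n))
               (sym (coeff-∷-*ₚ x p r n)))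
  where
  lemma₀ : ∀ p → coeff (p *ₚ (0ℤ ∷ r)) zero ≡ 0ℤ
  lemma₀ []      = refl
  lemma₀ (y ∷ p) =
    trans (coeff-∷-*ₚ y p (0ℤ ∷ r) zero)
          (trans (ℤ.+-identityʳ (y ℤ.* 0ℤ)) (ℤ.*-zeroʳ y))

  lemma : ∀ n → coeff (p *ₚ (0ℤ ∷ r)) n ≡ coeff (0ℤ ∷ p *ₚ r) n
  lemma zero    = lemma₀ p
  lemma (suc n) = coeff-*ₚ-0∷ p r n

∷-≈0 : ∀ {x p} → x ≡ 0ℤ → p ≈ 0ₚ → x ∷ p ≈ 0ₚ
∷-≈0 x≡0 p≈0 = mk≈ λ { zero → x≡0 ; (suc n) → coeff-≡ p≈0 n }

*ₚ-cancel-≢0 : ∀ {x} p r → ¬ x ≡ 0ℤ → (x ∷ p) *ₚ r ≈ 0ₚ → r ≈ 0ₚ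
*ₚ-cancel-≢0 p []      x≢0 eq = mk≈ λ _ → refl
*ₚ-cancel-≢0 {x} p (y ∷ r) x≢0 eq
  with ℤ.i*j≡0⇒i≡0∨j≡0 x
         (trans (sym (ℤ.+-identityʳ (x ℤ.* y))) (coeff-≡ eq zero))
... | inj₁ x≡0  = contradiction x≡0 x≢0
... | inj₂ refl = ∷-≈0 refl (*ₚ-cancel-≢0 p r x≢0
  (mk≈ λ n → trans (sym (coeff-*ₚ-0∷ (x ∷ p) r n)) (coeff-≡ eq (suc n))))

*ₚ≈0⇒≈0 : ∀ p r → p *ₚ r ≈ 0ₚ → p ≈ 0ₚ ⊎ r ≈ 0ₚ
*ₚ≈0⇒≈0 []      r eq = inj₁ (mk≈ λ _ → refl)
*ₚ≈0⇒≈0 (x ∷ p) r eq with x ℤ.≟ 0ℤ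
... | no x≢0   = inj₂ (*ₚ-cancel-≢0 p r x≢0 eq)
... | yes refl with *ₚ≈0⇒≈0 p r (mk≈ λ n →
        trans (sym (trans (coeff-∷-*ₚ 0ℤ p r (suc n)) (ℤ.+-identityˡ _)))
              (coeff-≡ eq (suc n)))
...   | inj₁ p≈0 = inj₁ (∷-≈0 refl p≈0)
...   | inj₂ r≈0 = inj₂ r≈0

*ₚ-≉0 : ∀ {p r} → ¬ p ≈ 0ₚ → ¬ r ≈ 0ₚ → ¬ p *ₚ r ≈ 0ₚ
*ₚ-≉0 {p} {r} p≉0 r≉0 pr≈0 = [ p≉0 , r≉0 ]′ (*ₚ≈0⇒≈0 p r pr≈0)

1∷-≉0 : ∀ {p} → ¬ 1ℤ ∷ p ≈ 0ₚ
1∷-≉0 eq with () ← coeff-≡ eq zero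

------------------------------------------------------------------------
-- The field ℚ(q), as the field of fractions of ℤ[q]

record RationalFunction : Set where
  constructor mkRF
  field
    num   : Poly
    den   : Poly
    den≉0 : ¬ den ≈ 0ₚ

open RationalFunction public

record _≃_ (f g : RationalFunction) : Set where
  constructor mk≃
  field
    cross : num f *ₚ den g ≈ num g *ₚ den f

open _≃_ public

ι : Poly → RationalFunction
ι p = mkRF p 1ₚ 1∷-≉0

_+ᶠ_ : RationalFunction → RationalFunction → RationalFunction
mkRF p d d≉0 +ᶠ mkRF r e e≉0 = mkRF (p *ₚ e +ₚ r *ₚ d) (d *ₚ e) (*ₚ-≉0 d≉0 e≉0)

_*ᶠ_ : RationalFunction → RationalFunction → RationalFunction
mkRF p d d≉0 *ᶠ mkRF r e e≉0 = mkRF (p *ₚ r) (d *ₚ e) (*ₚ-≉0 d≉0 e≉0)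

∑₁ : ℕ → (ℕ → RationalFunction) → RationalFunction
∑₁ zero    f = ι 0ₚ
∑₁ (suc n) f = ∑₁ n f +ᶠ f (suc n)

infix 5 ∑₁
syntax ∑₁ n (λ k → f) = ∑[1≤ k ≤ n ] f

------------------------------------------------------------------------
-- q-binomial coefficients

-- 1 + q + ⋯ + qⁿ⁻¹
[_]q : ℕ → Poly
[ n ]q = replicate n 1ℤ

[_]q! : ℕ → Poly
[ zero ]q!  = 1ₚ
[ suc n ]q! = [ n ]q! *ₚ [ suc n ]q

[n]q!≉0 : ∀ n → ¬ [ n ]q! ≈ 0ₚ
[n]q!≉0 zero    = 1∷-≉0
[n]q!≉0 (suc n) = *ₚ-≉0 ([n]q!≉0 n) 1∷-≉0

-- Meaningful for k ≤ n only, since n ∸ k is truncated subtraction.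
qBinomial : ℕ → ℕ → RationalFunction
qBinomial n k =
  mkRF [ n ]q! ([ k ]q! *ₚ [ n ∸ k ]q!) (*ₚ-≉0 ([n]q!≉0 k) ([n]q!≉0 (n ∸ k)))

------------------------------------------------------------------------
-- q-biperiodic Fibonacci sequences

ξ : ℕ → ℕ
ξ n = n ∸ 2 * ⌊ n /2⌋

ifEven_then_else_ : ∀ {A : Set} → ℕ → A → A → A
ifEven n then x else y with parity n
... | 0ℙ = x
... | 1ℙ = y

-- In the recursive clauses the index is n = m + 2, so qⁿ⁻² is qᵐ.
F : (a b : ℕ) → ℕ → Poly
F a b 0 = 0ₚ
F a b 1 = 1ₚ
F a b (suc (suc m)) =
  const (ifEven suc (suc m) then a else b) *ₚ F a b (suc m)
    +ₚ q ^ₚ m *ₚ F a b m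

shiftedF : (a b s : ℕ) → ℕ → Poly
shiftedF a b s 0 = 0ₚ
shiftedF a b s 1 = 1ₚ
shiftedF a b s (suc (suc m)) =
  const (ifEven suc (suc m)
         then a ^ ξ (s + 1) * b ^ (1 ∸ ξ (s + 1))
         else a ^ (1 ∸ ξ (s + 1)) * b ^ ξ (s + 1)) *ₚ shiftedF a b s (suc m)
    +ₚ q ^ₚ (m + s) *ₚ shiftedF a b s m

{-# OPTIONS --safe #-}
module Submission where

-- F⁽ˢ⁾ₙ is a continuant, so it can also be expanded from its first coefficient:
-- F⁽ˢ⁾ₘ₊₂ = cₛ F⁽ˢ⁺¹⁾ₘ₊₁ + qˢ⁺¹ F⁽ˢ⁺²⁾ₘ, where cₛ is a or b according to the
-- parity of s.  Applying this n times writes F⁽ˢ⁾ₘ₊₂ₙ as the sum over k of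
-- cₛ cₛ₊₁ ⋯ cₛ₊ₖ₋₁ w(s,n,k) F⁽ˢ⁺²ⁿ⁻ᵏ⁾ₘ₊ₖ, where
-- w(s,n+1,k+1) = w(s+1,n,k) + qˢ⁺¹ w(s+2,n,k+1).  This is solved by
-- w(s,k+j,k) = q^(j(j+s)) [k+j choose k]_q, by the q-Pascal rule.  Take s = m = 0.

open import Defs
open import Algebra.Bundles using (CommutativeMonoid; CommutativeSemiring)
import Algebra.Properties.CommutativeMonoid.Sum as Sum
import Algebra.Properties.CommutativeSemigroup as CommutativeSemigroupProperties
import Algebra.Properties.Semiring.Exp as Exp
import Algebra.Properties.Semiring.Sum as SemiringSum
import Algebra.Solver.Ring.NaturalCoefficients.Default as SemiringSolver
import Algebra.Structures.Biased as Biased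
open import Data.Fin.Base using (toℕ; fromℕ; inject₁)
open import Data.Fin.Properties using (toℕ-inject₁; toℕ-fromℕ)
open import Data.Integer.Base as ℤ using (+_; 0ℤ; 1ℤ)
import Data.Integer.Properties as ℤ
open import Data.List.Base using ([]; _∷_)
open import Data.Nat.Base
  using (ℕ; zero; suc; _+_; _*_; _∸_; _^_; ⌊_/2⌋; _≤_; _<_; s<s; z<s; NonZero)
import Data.Nat.Properties as ℕ
open import Data.Nat.Solver using (module +-*-Solver)
open import Data.Product.Base using (_,_)
open import Level using (0ℓ)
open import Relation.Binary.PropositionalEquality as ≡
  using (_≡_; refl; cong; cong₂; subst; module ≡-Reasoning)
import Relation.Binary.Reasoning.Setoid as SetoidReasoning

-- Continuants over a commutative semiring

module Continuants {c ℓ} (R : CommutativeSemiring c ℓ)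
  (α β : ℕ → CommutativeSemiring.Carrier R) where

  open CommutativeSemiring R hiding (zero)
    renaming (_+_ to _⊕_; _*_ to _⊗_; refl to ≈-refl; sym to ≈-sym; trans to ≈-trans; _≈_ to _≋_)
  open Sum +-commutativeMonoid using (sum; sum-cong-≋; sum-init-last; ∑-distrib-+)
  open SemiringSum semiring using (*-distribˡ-sum)
  open SemiringSolver R using (solve; _:+_; _:*_; _:=_; con)
  open SetoidReasoning setoid

  continuant : ℕ → ℕ → Carrier
  continuant s zero          = 0#
  continuant s (suc zero)    = 1#
  continuant s (suc (suc m)) =
    α (m + s) ⊗ continuant s (suc m) ⊕ β (m + s) ⊗ continuant s m

  -- The recurrence peels off the last coefficients; this peels off the first.
  continuant-left : ∀ s m →
    continuant s (suc (suc m)) ≋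
    α s ⊗ continuant (suc s) (suc m) ⊕ β (suc s) ⊗ continuant (suc (suc s)) m
  continuant-left s 0 =
    -- Both `x` and `y` multiply a continuant of length 0, which is 0, so `β s` on the left may
    -- become `β (suc s)` on the right.
    solve 3 (λ a x y → a :* con 1 :+ x :* con 0 := a :* con 1 :+ y :* con 0)
      ≈-refl (α s) (β s) (β (suc s))
  continuant-left s 1 =
    solve 4 (λ a b x y → b :* (a :* con 1 :+ x :* con 0) :+ y :* con 1
                       := a :* (b :* con 1 :+ y :* con 0) :+ y :* con 1)
      ≈-refl (α s) (α (suc s)) (β s) (β (suc s))
  continuant-left s (suc (suc m)) = begin
    b ⊗ continuant s (suc (suc (suc m))) ⊕ x ⊗ continuant s (suc (suc m))
      ≈⟨ +-cong (*-congˡ (continuant-left s (suc m))) (*-congˡ (continuant-left s m)) ⟩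
    b ⊗ (α s ⊗ f₂ ⊕ β (suc s) ⊗ g₁) ⊕ x ⊗ (α s ⊗ f₁ ⊕ β (suc s) ⊗ g₀)
      ≈⟨ solve 8 (λ a b x y f₂ g₁ f₁ g₀ →
                    b :* (a :* f₂ :+ y :* g₁) :+ x :* (a :* f₁ :+ y :* g₀)
                 := a :* (b :* f₂ :+ x :* f₁) :+ y :* (b :* g₁ :+ x :* g₀))
           ≈-refl (α s) b x (β (suc s)) f₂ g₁ f₁ g₀ ⟩
    α s ⊗ (b ⊗ f₂ ⊕ x ⊗ f₁) ⊕ β (suc s) ⊗ (b ⊗ g₁ ⊕ x ⊗ g₀)
      -- `b` and `x` carry the index m + 2 + s; the recurrences started at s + 1 and s + 2 spell it
      -- (m + 1) + (s + 1) and m + (s + 2).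
      ≡⟨ cong₂ (λ i j → α s ⊗ (α i ⊗ f₂ ⊕ β i ⊗ f₁) ⊕ β (suc s) ⊗ (α j ⊗ g₁ ⊕ β j ⊗ g₀))
           (ℕ.+-suc (suc m) s) (≡.trans (ℕ.+-suc m (suc s)) (cong suc (ℕ.+-suc m s))) ⟨
    α s ⊗ continuant (suc s) (suc (suc (suc m)))
      ⊕ β (suc s) ⊗ continuant (suc (suc s)) (suc (suc m))    ∎
    where
    b  = α (suc (suc (m + s)))
    x  = β (suc (suc (m + s)))
    f₂ = continuant (suc s) (suc (suc m))
    f₁ = continuant (suc s) (suc m)
    g₁ = continuant (suc (suc s)) (suc m)
    g₀ = continuant (suc (suc s)) m

  -- Each use of `continuant-left` takes a single step (factor from α, start raised by 1) or a
  -- double step (factor from β, start raised by 2). `weight s n k` sums the β-products over all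
  -- sequences of n steps with exactly k single ones.
  weight : ℕ → ℕ → ℕ → Carrier
  weight s zero    zero    = 1#
  weight s zero    (suc k) = 0#
  weight s (suc n) zero    = β (suc s) ⊗ weight (suc (suc s)) n zero
  weight s (suc n) (suc k) =
    weight (suc s) n k ⊕ β (suc s) ⊗ weight (suc (suc s)) n (suc k)

  -- A sequence of n steps contains at most n single ones.
  weight-zero : ∀ s {n k} → n < k → weight s n k ≋ 0#
  weight-zero s z<s = ≈-refl
  weight-zero s {suc n} {suc k} (s<s n<k) = begin
    weight (suc s) n k ⊕ β (suc s) ⊗ weight (suc (suc s)) n (suc k)
      ≈⟨ +-cong (weight-zero (suc s) n<k)
                (*-congˡ (weight-zero (suc (suc s)) (ℕ.m<n⇒m<1+n n<k))) ⟩
    0# ⊕ β (suc s) ⊗ 0#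
      ≈⟨ solve 1 (λ x → con 0 :+ x :* con 0 := con 0) ≈-refl (β (suc s)) ⟩
    0#    ∎

  αs : ℕ → ℕ → Carrier
  αs s zero    = 1#
  αs s (suc k) = α s ⊗ αs (suc s) k

  expansion : ℕ → ℕ → (ℕ → Carrier) → Carrier
  expansion s n g = sum {suc n} λ i → αs s (toℕ i) ⊗ weight s n (toℕ i) ⊗ g (toℕ i)

  expansion-cong : ∀ s n {g h} → (∀ k → g k ≡ h k) → expansion s n g ≋ expansion s n h
  expansion-cong s n g≡h =
    sum-cong-≋ {suc n} λ i →
      *-congˡ {αs s (toℕ i) ⊗ weight s n (toℕ i)} (reflexive (g≡h (toℕ i)))

  module _ (α-periodic : ∀ s → α (suc (suc s)) ≡ α s) where

    -- A double step moves the start by a full period of α. Hence the α-product depends only on the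
    -- number of single steps and factors out of the sum over step sequences.
    αs-periodic : ∀ s k → αs (suc (suc s)) k ≡ αs s k
    αs-periodic s zero    = refl
    αs-periodic s (suc k) = cong₂ _⊗_ (α-periodic s) (αs-periodic (suc s) k)

    -- Sorting by the first step: the recurrence of `weight` splits each term of positive index into
    -- a single-step and a double-step part, and the term of index 0 joins the double-step part.
    expansion-suc : ∀ s n g →
      expansion s (suc n) g ≋
      α s ⊗ expansion (suc s) n (λ k → g (suc k)) ⊕ β (suc s) ⊗ expansion (suc (suc s)) n g
    expansion-suc s n g = begin
      αs s 0 ⊗ weight s (suc n) 0 ⊗ g 0
        ⊕ sum {suc n} (λ i → αs s (suc (toℕ i)) ⊗ weight s (suc n) (suc (toℕ i)) ⊗ g (suc (toℕ i)))
        ≈⟨ +-cong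
             (solve 4 (λ a x w g → a :* (x :* w) :* g := x :* (a :* w :* g))
               ≈-refl (αs s 0) (β (suc s)) (weight (suc (suc s)) n 0) (g 0))
             (sum-cong-≋ {suc n} λ i → split (toℕ i)) ⟩
      β (suc s) ⊗ v 0 ⊕ sum {suc n} (λ i → α s ⊗ u (toℕ i) ⊕ β (suc s) ⊗ v (suc (toℕ i)))
        ≈⟨ +-congˡ (∑-distrib-+ {suc n} (λ i → α s ⊗ u (toℕ i)) (λ i → β (suc s) ⊗ v (suc (toℕ i)))) ⟩
      β (suc s) ⊗ v 0 ⊕ (sum {suc n} (λ i → α s ⊗ u (toℕ i))
        ⊕ sum {suc n} (λ i → β (suc s) ⊗ v (suc (toℕ i))))
        ≈⟨ +-congˡ (+-cong (*-distribˡ-sum {suc n} (α s) (λ i → u (toℕ i)))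
                           (*-distribˡ-sum {suc n} (β (suc s)) (λ i → v (suc (toℕ i))))) ⟨
      β (suc s) ⊗ v 0 ⊕ (α s ⊗ sum {suc n} (λ i → u (toℕ i))
        ⊕ β (suc s) ⊗ sum {suc n} (λ i → v (suc (toℕ i))))
        ≈⟨ solve 5 (λ a x v U V → x :* v :+ (a :* U :+ x :* V) := a :* U :+ x :* (v :+ V))
             ≈-refl (α s) (β (suc s)) (v 0) _ _ ⟩
      α s ⊗ sum {suc n} (λ i → u (toℕ i)) ⊕ β (suc s) ⊗ sum {suc (suc n)} (λ i → v (toℕ i))
        -- The double-step sum still runs up to k = n + 1, where the weight vanishes; periodicity
        -- moves the start of its α-product from s to s + 2.
        ≈⟨ +-congˡ (*-congˡ truncate) ⟩
      α s ⊗ expansion (suc s) n (λ k → g (suc k)) ⊕ β (suc s) ⊗ expansion (suc (suc s)) n g    ∎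
      where
      u v v′ : ℕ → Carrier
      u k  = αs (suc s) k ⊗ weight (suc s) n k ⊗ g (suc k)
      v k  = αs s k ⊗ weight (suc (suc s)) n k ⊗ g k
      v′ k = αs (suc (suc s)) k ⊗ weight (suc (suc s)) n k ⊗ g k

      split : ∀ k →
        αs s (suc k) ⊗ weight s (suc n) (suc k) ⊗ g (suc k) ≋ α s ⊗ u k ⊕ β (suc s) ⊗ v (suc k)
      split k =
        solve 6 (λ a A w x w′ g → a :* A :* (w :+ x :* w′) :* g
                               := a :* (A :* w :* g) :+ x :* (a :* A :* w′ :* g))
          ≈-refl (α s) (αs (suc s) k) (weight (suc s) n k) (β (suc s))
          (weight (suc (suc s)) n (suc k)) (g (suc k))

      v-last : v (suc n) ≋ 0#
      v-last = begin
        αs s (suc n) ⊗ weight (suc (suc s)) n (suc n) ⊗ g (suc n)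
          ≈⟨ *-congʳ (*-congˡ (weight-zero (suc (suc s)) (ℕ.n<1+n n))) ⟩
        αs s (suc n) ⊗ 0# ⊗ g (suc n)
          ≈⟨ solve 2 (λ A g → A :* con 0 :* g := con 0) ≈-refl (αs s (suc n)) (g (suc n)) ⟩
        0#    ∎

      truncate : sum {suc (suc n)} (λ i → v (toℕ i)) ≋ expansion (suc (suc s)) n g
      truncate = begin
        sum {suc (suc n)} (λ i → v (toℕ i))
          ≈⟨ sum-init-last {suc n} (λ i → v (toℕ i)) ⟩
        sum {suc n} (λ i → v (toℕ (inject₁ i))) ⊕ v (toℕ (fromℕ (suc n)))
          ≈⟨ +-cong
               (sum-cong-≋ {suc n} λ i → reflexive
                 (≡.trans (cong v (toℕ-inject₁ i))
                          (cong (λ A → A ⊗ weight (suc (suc s)) n (toℕ i) ⊗ g (toℕ i))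
                                (≡.sym (αs-periodic s (toℕ i))))))
               (≈-trans (reflexive (cong v (toℕ-fromℕ (suc n)))) v-last) ⟩
        expansion (suc (suc s)) n g ⊕ 0#
          ≈⟨ +-identityʳ _ ⟩
        expansion (suc (suc s)) n g    ∎

    -- Every continuant in the sum ends at the same coefficient, which is what
    -- fixing T = s + (m + 2n) expresses.
    continuant-expansion : ∀ n s m {T} → T ≡ s + (m + 2 * n) →
      continuant s (m + 2 * n) ≋ expansion s n (λ k → continuant (T ∸ (m + k)) (m + k))
    continuant-expansion zero s m {T} T≡ = begin
      continuant s (m + 0)
        ≡⟨ cong (λ t → continuant t (m + 0))
             (≡.trans (cong (_∸ (m + 0)) T≡) (ℕ.m+n∸n≡m s (m + 0))) ⟨
      continuant (T ∸ (m + 0)) (m + 0)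
        -- Only k = 0 remains, with `αs` and `weight` both equal to 1.
        ≈⟨ solve 1 (λ x → x := con 1 :* con 1 :* x :+ con 0) ≈-refl _ ⟩
      expansion s zero (λ k → continuant (T ∸ (m + k)) (m + k))    ∎
    continuant-expansion (suc n) s m {T} T≡ = begin
      continuant s (m + 2 * suc n)
        ≡⟨ cong (continuant s) m+2+2n ⟩
      continuant s (suc (suc (m + 2 * n)))
        ≈⟨ continuant-left s (m + 2 * n) ⟩
      α s ⊗ continuant (suc s) (suc m + 2 * n) ⊕ β (suc s) ⊗ continuant (suc (suc s)) (m + 2 * n)
        ≈⟨ +-cong
             -- A single step raises s and m by 1, a double step raises s by 2; either way T is
             -- unchanged as n drops by 1. After the single step, (m + 1) + k is reread as m + (k +
             -- 1), the shifted summand of `expansion-suc`.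
             (*-congˡ (≈-trans
               (continuant-expansion n (suc s) (suc m) (≡.trans T≡′ (ℕ.+-suc s _)))
               (expansion-cong (suc s) n λ k →
                 cong (λ i → continuant (T ∸ i) i) (≡.sym (ℕ.+-suc m k)))))
             (*-congˡ (continuant-expansion n (suc (suc s)) m
               (≡.trans T≡′ (≡.trans (ℕ.+-suc s _) (cong suc (ℕ.+-suc s _)))))) ⟩
      α s ⊗ expansion (suc s) n (λ k → continuant (T ∸ (m + suc k)) (m + suc k))
        ⊕ β (suc s) ⊗ expansion (suc (suc s)) n (λ k → continuant (T ∸ (m + k)) (m + k))
        ≈⟨ expansion-suc s n (λ k → continuant (T ∸ (m + k)) (m + k)) ⟨
      expansion s (suc n) (λ k → continuant (T ∸ (m + k)) (m + k))    ∎
      where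
      m+2+2n : m + 2 * suc n ≡ suc (suc (m + 2 * n))
      m+2+2n = ≡.trans (cong (_+_ m) (ℕ.*-suc 2 n))
                 (≡.trans (ℕ.+-suc m (suc (2 * n))) (cong suc (ℕ.+-suc m (2 * n))))
      T≡′ : T ≡ s + suc (suc (m + 2 * n))
      T≡′ = ≡.trans T≡ (cong (_+_ s) m+2+2n)

-- ℤ[q] is a commutative semiring

∷-cong : ∀ {x y p r} → x ≡ y → p ≈ r → x ∷ p ≈ y ∷ r
∷-cong x≡y p≈r = mk≈ λ { zero → x≡y ; (suc n) → coeff-≡ p≈r n }

+ₚ-cong : ∀ {p p′ r r′} → p ≈ p′ → r ≈ r′ → p +ₚ r ≈ p′ +ₚ r′
+ₚ-cong {p} {p′} {r} {r′} p≈p′ r≈r′ = mk≈ λ n → begin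
  coeff (p +ₚ r) n             ≡⟨ coeff-+ₚ p r n ⟩
  coeff p n ℤ.+ coeff r n      ≡⟨ cong₂ ℤ._+_ (coeff-≡ p≈p′ n) (coeff-≡ r≈r′ n) ⟩
  coeff p′ n ℤ.+ coeff r′ n    ≡⟨ coeff-+ₚ p′ r′ n ⟨
  coeff (p′ +ₚ r′) n           ∎
  where open ≡-Reasoning

+ₚ-assoc : ∀ p r t → (p +ₚ r) +ₚ t ≡ p +ₚ (r +ₚ t)
+ₚ-assoc []      r       t       = refl
+ₚ-assoc (x ∷ p) []      t       = refl
+ₚ-assoc (x ∷ p) (y ∷ r) []      = refl
+ₚ-assoc (x ∷ p) (y ∷ r) (z ∷ t) = cong₂ _∷_ (ℤ.+-assoc x y z) (+ₚ-assoc p r t)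

+ₚ-comm : ∀ p r → p +ₚ r ≡ r +ₚ p
+ₚ-comm []      []      = refl
+ₚ-comm []      (y ∷ r) = refl
+ₚ-comm (x ∷ p) []      = refl
+ₚ-comm (x ∷ p) (y ∷ r) = cong₂ _∷_ (ℤ.+-comm x y) (+ₚ-comm p r)

+ₚ-commutativeMonoid : CommutativeMonoid 0ℓ 0ℓ
+ₚ-commutativeMonoid = record
  { _≈_ = _≈_
  ; _∙_ = _+ₚ_
  ; ε   = 0ₚ
  ; isCommutativeMonoid = record
    { isMonoid = record
      { isSemigroup = record
        { isMagma = record
          { isEquivalence = record
            { refl  = mk≈ λ _ → refl
            ; sym   = λ p≈r → mk≈ λ n → ≡.sym (coeff-≡ p≈r n)
            ; trans = λ p≈r r≈t → mk≈ λ n → ≡.trans (coeff-≡ p≈r n) (coeff-≡ r≈t n)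
            }
          ; ∙-cong = +ₚ-cong
          }
        ; assoc = λ p r t → ≡⇒≈ (+ₚ-assoc p r t)
        }
      ; identity = (λ _ → ≡⇒≈ refl) , λ p → ≡⇒≈ (+ₚ-comm p [])
      }
    ; comm = λ p r → ≡⇒≈ (+ₚ-comm p r)
    }
  }
  where
  ≡⇒≈ : ∀ {p r} → p ≡ r → p ≈ r
  ≡⇒≈ refl = mk≈ λ _ → refl

private
  module + = CommutativeMonoid +ₚ-commutativeMonoid
  module +-Properties = CommutativeSemigroupProperties +.commutativeSemigroup

·ₚ-cong : ∀ x {p r} → p ≈ r → x ·ₚ p ≈ x ·ₚ r
·ₚ-cong x {p} {r} p≈r = mk≈ λ n →
  ≡.trans (coeff-·ₚ x p n)
    (≡.trans (cong (x ℤ.*_) (coeff-≡ p≈r n)) (≡.sym (coeff-·ₚ x r n)))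

0·ₚ : ∀ p → 0ℤ ·ₚ p ≈ 0ₚ
0·ₚ p = mk≈ (coeff-·ₚ 0ℤ p)

·ₚ-+ₚ : ∀ x p r → x ·ₚ (p +ₚ r) ≡ x ·ₚ p +ₚ x ·ₚ r
·ₚ-+ₚ x []      r       = refl
·ₚ-+ₚ x (y ∷ p) []      = refl
·ₚ-+ₚ x (y ∷ p) (z ∷ r) = cong₂ _∷_ (ℤ.*-distribˡ-+ x y z) (·ₚ-+ₚ x p r)

+-·ₚ : ∀ x y p → (x ℤ.+ y) ·ₚ p ≡ x ·ₚ p +ₚ y ·ₚ p
+-·ₚ x y []      = refl
+-·ₚ x y (z ∷ p) = cong₂ _∷_ (ℤ.*-distribʳ-+ z x y) (+-·ₚ x y p)

*-·ₚ : ∀ x y p → (x ℤ.* y) ·ₚ p ≡ x ·ₚ (y ·ₚ p)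
*-·ₚ x y []      = refl
*-·ₚ x y (z ∷ p) = cong₂ _∷_ (ℤ.*-assoc x y z) (*-·ₚ x y p)

1·ₚ : ∀ p → 1ℤ ·ₚ p ≡ p
1·ₚ []      = refl
1·ₚ (x ∷ p) = cong₂ _∷_ (ℤ.*-identityˡ x) (1·ₚ p)

*ₚ-congˡ : ∀ p {r t} → r ≈ t → p *ₚ r ≈ p *ₚ t
*ₚ-congˡ []      r≈t = +.refl
*ₚ-congˡ (x ∷ p) r≈t = +ₚ-cong (·ₚ-cong x r≈t) (∷-cong refl (*ₚ-congˡ p r≈t))

*ₚ-zeroʳ : ∀ p → p *ₚ 0ₚ ≈ 0ₚ
*ₚ-zeroʳ []      = +.refl
*ₚ-zeroʳ (x ∷ p) = ∷-≈0 refl (*ₚ-zeroʳ p)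

-- Multiplication recurses on its left factor; this mirror image in the right factor is what the
-- induction for commutativity needs.
*ₚ-∷ : ∀ p y r → p *ₚ (y ∷ r) ≈ y ·ₚ p +ₚ (0ℤ ∷ p *ₚ r)
*ₚ-∷ []      y r = +.sym (∷-≈0 refl +.refl)
*ₚ-∷ (x ∷ p) y r = ∷-cong (cong (ℤ._+ 0ℤ) (ℤ.*-comm x y)) (begin
  x ·ₚ r +ₚ p *ₚ (y ∷ r)                  ≈⟨ +.∙-congˡ (*ₚ-∷ p y r) ⟩
  x ·ₚ r +ₚ (y ·ₚ p +ₚ (0ℤ ∷ p *ₚ r))    ≈⟨ +-Properties.x∙yz≈y∙xz (x ·ₚ r) (y ·ₚ p) (0ℤ ∷ p *ₚ r) ⟩
  y ·ₚ p +ₚ (x ·ₚ r +ₚ (0ℤ ∷ p *ₚ r))    ∎)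
  where open SetoidReasoning +.setoid

*ₚ-comm : ∀ p r → p *ₚ r ≈ r *ₚ p
*ₚ-comm []      r = +.sym (*ₚ-zeroʳ r)
*ₚ-comm (x ∷ p) r = begin
  x ·ₚ r +ₚ (0ℤ ∷ p *ₚ r)    ≈⟨ +.∙-congˡ (∷-cong refl (*ₚ-comm p r)) ⟩
  x ·ₚ r +ₚ (0ℤ ∷ r *ₚ p)    ≈⟨ *ₚ-∷ r x p ⟨
  r *ₚ (x ∷ p)                ∎
  where open SetoidReasoning +.setoid

-- Equal polynomials may be lists of different lengths, so congruence on the left is obtained from
-- congruence on the right by commutativity.
*ₚ-cong : ∀ {p p′ r r′} → p ≈ p′ → r ≈ r′ → p *ₚ r ≈ p′ *ₚ r′
*ₚ-cong {p} {p′} {r} {r′} p≈p′ r≈r′ = begin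
  p *ₚ r      ≈⟨ *ₚ-congˡ p r≈r′ ⟩
  p *ₚ r′     ≈⟨ *ₚ-comm p r′ ⟩
  r′ *ₚ p     ≈⟨ *ₚ-congˡ r′ p≈p′ ⟩
  r′ *ₚ p′    ≈⟨ *ₚ-comm r′ p′ ⟩
  p′ *ₚ r′    ∎
  where open SetoidReasoning +.setoid

*ₚ-distribʳ-+ₚ : ∀ t p r → (p +ₚ r) *ₚ t ≈ p *ₚ t +ₚ r *ₚ t
*ₚ-distribʳ-+ₚ t []      r       = +.refl
*ₚ-distribʳ-+ₚ t (x ∷ p) []      = +.sym (+.identityʳ _)
*ₚ-distribʳ-+ₚ t (x ∷ p) (y ∷ r) = begin
  (x ℤ.+ y) ·ₚ t +ₚ (0ℤ ∷ (p +ₚ r) *ₚ t)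
    ≈⟨ +ₚ-cong (+.reflexive (+-·ₚ x y t)) (∷-cong refl (*ₚ-distribʳ-+ₚ t p r)) ⟩
  (x ·ₚ t +ₚ y ·ₚ t) +ₚ ((0ℤ ∷ p *ₚ t) +ₚ (0ℤ ∷ r *ₚ t))
    ≈⟨ +-Properties.interchange (x ·ₚ t) (y ·ₚ t) (0ℤ ∷ p *ₚ t) (0ℤ ∷ r *ₚ t) ⟩
  (x ·ₚ t +ₚ (0ℤ ∷ p *ₚ t)) +ₚ (y ·ₚ t +ₚ (0ℤ ∷ r *ₚ t))    ∎
  where open SetoidReasoning +.setoid

·ₚ-*ₚ : ∀ x p r → (x ·ₚ p) *ₚ r ≈ x ·ₚ (p *ₚ r)
·ₚ-*ₚ x []      r = +.refl
·ₚ-*ₚ x (y ∷ p) r = begin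
  (x ℤ.* y) ·ₚ r +ₚ (0ℤ ∷ (x ·ₚ p) *ₚ r)
    ≈⟨ +ₚ-cong (+.reflexive (*-·ₚ x y r)) (∷-cong (≡.sym (ℤ.*-zeroʳ x)) (·ₚ-*ₚ x p r)) ⟩
  x ·ₚ (y ·ₚ r) +ₚ x ·ₚ (0ℤ ∷ p *ₚ r)
    ≡⟨ ·ₚ-+ₚ x (y ·ₚ r) (0ℤ ∷ p *ₚ r) ⟨
  x ·ₚ (y ·ₚ r +ₚ (0ℤ ∷ p *ₚ r))    ∎
  where open SetoidReasoning +.setoid

0∷-*ₚ : ∀ p r → (0ℤ ∷ p) *ₚ r ≈ 0ℤ ∷ p *ₚ r
0∷-*ₚ p r = +.∙-congʳ (0·ₚ r)

*ₚ-assoc : ∀ p r t → (p *ₚ r) *ₚ t ≈ p *ₚ (r *ₚ t)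
*ₚ-assoc []      r t = +.refl
*ₚ-assoc (x ∷ p) r t = begin
  (x ·ₚ r +ₚ (0ℤ ∷ p *ₚ r)) *ₚ t
    ≈⟨ *ₚ-distribʳ-+ₚ t (x ·ₚ r) (0ℤ ∷ p *ₚ r) ⟩
  (x ·ₚ r) *ₚ t +ₚ (0ℤ ∷ p *ₚ r) *ₚ t
    ≈⟨ +ₚ-cong (·ₚ-*ₚ x r t) (0∷-*ₚ (p *ₚ r) t) ⟩
  x ·ₚ (r *ₚ t) +ₚ (0ℤ ∷ (p *ₚ r) *ₚ t)
    ≈⟨ +.∙-congˡ (∷-cong refl (*ₚ-assoc p r t)) ⟩
  x ·ₚ (r *ₚ t) +ₚ (0ℤ ∷ p *ₚ (r *ₚ t))    ∎
  where open SetoidReasoning +.setoid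

*ₚ-identityˡ : ∀ p → 1ₚ *ₚ p ≈ p
*ₚ-identityˡ p = begin
  1ℤ ·ₚ p +ₚ (0ℤ ∷ [])    ≈⟨ +ₚ-cong (+.reflexive (1·ₚ p)) (∷-≈0 refl +.refl) ⟩
  p +ₚ 0ₚ                  ≈⟨ +.identityʳ p ⟩
  p                        ∎
  where open SetoidReasoning +.setoid

polyCommutativeSemiring : CommutativeSemiring 0ℓ 0ℓ
polyCommutativeSemiring = record
  { isCommutativeSemiring = Biased.isCommutativeSemiringˡ record
    { +-isCommutativeMonoid = +.isCommutativeMonoid
    ; *-isCommutativeMonoid = record
      { isMonoid = record
        { isSemigroup = record
          { isMagma = record { isEquivalence = +.isEquivalence ; ∙-cong = *ₚ-cong }
          ; assoc   = *ₚ-assoc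
          }
        ; identity = *ₚ-identityˡ
                   , λ p → +.trans (*ₚ-comm p 1ₚ) (*ₚ-identityˡ p)
        }
      ; comm = *ₚ-comm
      }
    ; distribʳ = *ₚ-distribʳ-+ₚ
    ; zeroˡ    = λ _ → +.refl
    }
  }

module ℤ[q] = CommutativeSemiring polyCommutativeSemiring
open ℤ[q] using (setoid; semiring) renaming (refl to ≈-refl; sym to ≈-sym; trans to ≈-trans)
open Exp semiring using (^-homo-*)
open Sum ℤ[q].+-commutativeMonoid using (sum; sum-cong-≋; sum-init-last)
open SemiringSolver polyCommutativeSemiring using (solve; _:+_; _:*_; _:=_; con)

-- Constants, powers of q and q-integers

const-* : ∀ m n → const (m * n) ≈ const m *ₚ const n
const-* m n =
  ∷-cong (≡.trans (ℤ.pos-* m n) (≡.sym (ℤ.+-identityʳ (+ m ℤ.* + n)))) ≈-refl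

q^-+ : ∀ {m} n o → m ≡ n + o → q ^ₚ m ≈ q ^ₚ n *ₚ q ^ₚ o
q^-+ n o refl = ^-homo-* q n o

[suc]q : ∀ n → [ suc n ]q ≈ 1ₚ +ₚ q *ₚ [ n ]q
[suc]q n = +.sym (+.∙-congˡ {1ₚ}
  (+.trans (0∷-*ₚ 1ₚ [ n ]q) (∷-cong refl (*ₚ-identityˡ [ n ]q))))

-- Cut the geometric sum after its first m terms. This is the additive identity behind the q-Pascal
-- rule.
[]q-+ : ∀ m n → [ m + n ]q ≈ [ m ]q +ₚ q ^ₚ m *ₚ [ n ]q
[]q-+ zero    n = ≈-sym (*ₚ-identityˡ [ n ]q)
[]q-+ (suc m) n = begin
  [ suc (m + n) ]q
    ≈⟨ [suc]q (m + n) ⟩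
  1ₚ +ₚ q *ₚ [ m + n ]q
    ≈⟨ ℤ[q].+-congˡ {1ₚ} (ℤ[q].*-congˡ {q} ([]q-+ m n)) ⟩
  1ₚ +ₚ q *ₚ ([ m ]q +ₚ q ^ₚ m *ₚ [ n ]q)
    ≈⟨ solve 4 (λ x i y i′ → con 1 :+ x :* (i :+ y :* i′) := (con 1 :+ x :* i) :+ (x :* y) :* i′)
         ≈-refl q [ m ]q (q ^ₚ m) [ n ]q ⟩
  (1ₚ +ₚ q *ₚ [ m ]q) +ₚ (q *ₚ q ^ₚ m) *ₚ [ n ]q
    ≈⟨ ℤ[q].+-congʳ {(q *ₚ q ^ₚ m) *ₚ [ n ]q} ([suc]q m) ⟨
  [ suc m ]q +ₚ q ^ₚ suc m *ₚ [ n ]q    ∎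
  where open SetoidReasoning setoid

-- Effect of a double step on the exponent j(j + s): its factor of exponent s + 1 turns the value at
-- (s + 2, j) into the value at (s, j + 1).
exponent-suc : ∀ s j → suc j * (suc j + s) ≡ suc s + j * (j + suc (suc s))
exponent-suc = ℕS.solve 2
  (λ s j → (ℕS.con 1 ℕS.:+ j) ℕS.:* (ℕS.con 1 ℕS.:+ j ℕS.:+ s)
     ℕS.:= ℕS.con 1 ℕS.:+ s ℕS.:+ j ℕS.:* (j ℕS.:+ (ℕS.con 2 ℕS.:+ s))) refl
  where module ℕS = +-*-Solver

-- Effect of a single step: the start s + 1 instead of s costs the extra power of exponent j + 1
-- that appears in the q-Pascal rule.
exponent-shift : ∀ s j → suc j * (suc j + suc s) ≡ suc j + suc j * (suc j + s)
exponent-shift s j = ≡.trans (cong (suc j *_) (ℕ.+-suc (suc j) s)) (ℕ.*-suc (suc j) (suc j + s))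

-- Fractions equal to a polynomial

≃-ι-resp-≈ : ∀ {f p r} → p ≈ r → f ≃ ι p → f ≃ ι r
≃-ι-resp-≈ {f} p≈r f≃p = mk≃ (≈-trans (cross f≃p) (ℤ[q].*-congʳ {den f} p≈r))

ι-≃ : ∀ {f p r} → p ≈ r → f ≃ ι r → ι p ≃ f
ι-≃ p≈r f≃r = mk≃ (≈-sym (cross (≃-ι-resp-≈ (≈-sym p≈r) f≃r)))

-- Against a polynomial the cross-multiplied equation reads `P *ₚ 1ₚ ≈ p *ₚ d`, so multiplying the
-- two equations by `e` and `d` and adding suffices, without cancelling any factor.
+ᶠ-≃-ι : ∀ f g {p r} → f ≃ ι p → g ≃ ι r → f +ᶠ g ≃ ι (p +ₚ r)
+ᶠ-≃-ι (mkRF P d _) (mkRF R e _) {p} {r} f≃p g≃r = mk≃ (begin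
  (P *ₚ e +ₚ R *ₚ d) *ₚ 1ₚ
    ≈⟨ solve 4 (λ P d R e → (P :* e :+ R :* d) :* con 1 := (P :* con 1) :* e :+ (R :* con 1) :* d)
         ≈-refl P d R e ⟩
  (P *ₚ 1ₚ) *ₚ e +ₚ (R *ₚ 1ₚ) *ₚ d
    ≈⟨ ℤ[q].+-cong (ℤ[q].*-congʳ {e} (cross f≃p)) (ℤ[q].*-congʳ {d} (cross g≃r)) ⟩
  (p *ₚ d) *ₚ e +ₚ (r *ₚ e) *ₚ d
    ≈⟨ solve 4 (λ p d r e → (p :* d) :* e :+ (r :* e) :* d := (p :+ r) :* (d :* e))
         ≈-refl p d r e ⟩
  (p +ₚ r) *ₚ (d *ₚ e)    ∎)
  where open SetoidReasoning setoid

∑₁-≃-ι : ∀ n {f} (g : ℕ → Poly) → (∀ k → k < n → f (suc k) ≃ ι (g k)) →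
  ∑₁ n f ≃ ι (sum {n} (λ i → g (toℕ i)))
∑₁-≃-ι zero    g f≃g = mk≃ ≈-refl
∑₁-≃-ι (suc n) {f} g f≃g =
  ≃-ι-resp-≈ (≈-sym snoc)
    (+ᶠ-≃-ι (∑₁ n f) (f (suc n))
      (∑₁-≃-ι n g λ k k<n → f≃g k (ℕ.m<n⇒m<1+n k<n))
      (f≃g n (ℕ.n<1+n n)))
  where
  -- `sum` unfolds at its first term, whereas `∑₁` unfolds at its last.
  snoc : sum {suc n} (λ i → g (toℕ i)) ≈ sum {n} (λ i → g (toℕ i)) +ₚ g n
  snoc = ≈-trans (sum-init-last {n} (λ i → g (toℕ i)))
    (ℤ[q].+-cong (sum-cong-≋ {n} λ i → ℤ[q].reflexive (cong g (toℕ-inject₁ i)))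
                 (ℤ[q].reflexive (cong g (toℕ-fromℕ n))))

-- Biperiodic coefficients

alternate : ℕ → ℕ → ℕ → ℕ
alternate a b zero    = a
alternate a b (suc s) = alternate b a s

alternateProduct : ℕ → ℕ → ℕ → ℕ → ℕ
alternateProduct a b s zero    = 1
alternateProduct a b s (suc k) = alternate a b s * alternateProduct a b (suc s) k

alternateProduct-periodic : ∀ a b s k →
  alternateProduct a b (suc (suc s)) k ≡ alternateProduct a b s k
alternateProduct-periodic a b s zero    = refl
alternateProduct-periodic a b s (suc k) =
  cong (alternate a b s *_) (alternateProduct-periodic a b (suc s) k)

ξ-periodic : ∀ n → ξ (suc (suc n)) ≡ ξ n
ξ-periodic n = cong (suc (suc n) ∸_) (ℕ.*-suc 2 ⌊ n /2⌋)

-- Induction in steps of two: each consecutive pair contributes ab, and an odd k leaves one factor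
-- a.
alternateProduct-closed : ∀ a b k → alternateProduct a b 0 k ≡ a ^ ξ k * (a * b) ^ ⌊ k /2⌋
alternateProduct-closed a b 0 = refl
alternateProduct-closed a b 1 = ≡.sym (ℕ.*-identityʳ (a * 1))
alternateProduct-closed a b (suc (suc k)) = begin
  a * (b * alternateProduct a b 2 k)
    ≡⟨ cong (λ x → a * (b * x)) (alternateProduct-periodic a b 0 k) ⟩
  a * (b * alternateProduct a b 0 k)
    ≡⟨ cong (λ x → a * (b * x)) (alternateProduct-closed a b k) ⟩
  a * (b * (a ^ ξ k * (a * b) ^ ⌊ k /2⌋))
    ≡⟨ ℕS.solve 4 (λ a b x y → a ℕS.:* (b ℕS.:* (x ℕS.:* y)) ℕS.:= x ℕS.:* ((a ℕS.:* b) ℕS.:* y))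
         refl a b (a ^ ξ k) ((a * b) ^ ⌊ k /2⌋) ⟩
  a ^ ξ k * (a * b) ^ suc ⌊ k /2⌋
    ≡⟨ cong (λ e → a ^ e * (a * b) ^ suc ⌊ k /2⌋) (ξ-periodic k) ⟨
  a ^ ξ (suc (suc k)) * (a * b) ^ suc ⌊ k /2⌋    ∎
  where
  open ≡-Reasoning
  module ℕS = +-*-Solver

-- `ξ (s + 1)` is 1 for even s and 0 for odd s, so exactly one base survives. With a and b exchanged
-- this also treats the odd branch of `shiftedF`.
alternate-ξ : ∀ a b s → a ^ ξ (s + 1) * b ^ (1 ∸ ξ (s + 1)) ≡ alternate a b s
alternate-ξ a b 0 = ≡.trans (ℕ.*-identityʳ (a * 1)) (ℕ.*-identityʳ a)
alternate-ξ a b 1 = ≡.trans (ℕ.*-identityˡ (b * 1)) (ℕ.*-identityʳ b)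
alternate-ξ a b (suc (suc s)) rewrite ξ-periodic (s + 1) = alternate-ξ a b s

ifEven-alternate : ∀ a b m → (ifEven m then a else b) ≡ alternate a b m
ifEven-alternate a b 0             = refl
ifEven-alternate a b 1             = refl
ifEven-alternate a b (suc (suc m)) = ifEven-alternate a b m

alternate-+ : ∀ a b m s →
  alternate (alternate a b s) (alternate b a s) m ≡ alternate a b (m + s)
alternate-+ a b zero    s = refl
alternate-+ a b (suc m) s = alternate-+ b a m s

-- An odd shift exchanges a and b, so the coefficient depends on m + s alone, as the recurrence of a
-- continuant requires.
shiftedF-coefficient : ∀ a b s m →
  (ifEven suc (suc m)
   then a ^ ξ (s + 1) * b ^ (1 ∸ ξ (s + 1))
   else a ^ (1 ∸ ξ (s + 1)) * b ^ ξ (s + 1)) ≡ alternate a b (m + s)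
shiftedF-coefficient a b s m =
  ≡.trans (cong₂ (λ x y → ifEven suc (suc m) then x else y)
                 (alternate-ξ a b s)
                 (≡.trans (ℕ.*-comm (a ^ (1 ∸ ξ (s + 1))) (b ^ ξ (s + 1))) (alternate-ξ b a s)))
    (≡.trans (ifEven-alternate (alternate a b s) (alternate b a s) (suc (suc m)))
             (alternate-+ a b m s))

-- Fibonacci polynomials as continuants, weights as q-binomials

module _ (a b : ℕ) where

  open Continuants polyCommutativeSemiring (λ s → const (alternate a b s)) (q ^ₚ_)

  shiftedF≡continuant : ∀ s n → shiftedF a b s n ≡ continuant s n
  shiftedF≡continuant s 0 = refl
  shiftedF≡continuant s 1 = refl
  shiftedF≡continuant s (suc (suc m)) =
    cong₂ _+ₚ_
      (cong₂ (λ c f → const c *ₚ f) (shiftedF-coefficient a b s m) (shiftedF≡continuant s (suc m)))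
      (cong (q ^ₚ (m + s) *ₚ_) (shiftedF≡continuant s m))

  F≡continuant : ∀ n → F a b n ≡ continuant 0 n
  F≡continuant 0 = refl
  F≡continuant 1 = refl
  F≡continuant (suc (suc m)) =
    cong₂ _+ₚ_
      (cong₂ (λ c f → const c *ₚ f)
        (≡.trans (ifEven-alternate a b (suc (suc m))) (cong (alternate a b) (≡.sym (ℕ.+-identityʳ m))))
        (F≡continuant (suc m)))
      (cong₂ (λ i f → q ^ₚ i *ₚ f) (≡.sym (ℕ.+-identityʳ m)) (F≡continuant m))

  αs≈const : ∀ s k → αs s k ≈ const (alternateProduct a b s k)
  αs≈const s zero    = ≈-refl
  αs≈const s (suc k) =
    ≈-trans (ℤ[q].*-congˡ {const (alternate a b s)} (αs≈const (suc s) k))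
            (≈-sym (const-* (alternate a b s) (alternateProduct a b (suc s) k)))

  αs-closed : ∀ k → αs 0 k ≈ const (a ^ ξ k) *ₚ const ((a * b) ^ ⌊ k /2⌋)
  αs-closed k = ≈-trans (αs≈const 0 k)
    (≈-trans (ℤ[q].reflexive (cong const (alternateProduct-closed a b k)))
             (const-* (a ^ ξ k) ((a * b) ^ ⌊ k /2⌋)))

  -- The q-Pascal rule with denominators cleared.
  weight-closed : ∀ s k j →
    weight s (k + j) k *ₚ ([ k ]q! *ₚ [ j ]q!) ≈ q ^ₚ (j * (j + s)) *ₚ [ k + j ]q!
  weight-closed s zero zero = ≈-refl
  weight-closed s zero (suc j) = begin
    (x *ₚ w) *ₚ (1ₚ *ₚ ([ j ]q! *ₚ [ suc j ]q))
      ≈⟨ solve 4 (λ x w f i → x :* w :* (con 1 :* (f :* i)) := x :* (w :* (con 1 :* f)) :* i)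
           ≈-refl x w [ j ]q! [ suc j ]q ⟩
    x *ₚ (w *ₚ (1ₚ *ₚ [ j ]q!)) *ₚ [ suc j ]q
      ≈⟨ ℤ[q].*-congʳ {[ suc j ]q} (ℤ[q].*-congˡ {x} (weight-closed (suc (suc s)) zero j)) ⟩
    x *ₚ (y *ₚ [ j ]q!) *ₚ [ suc j ]q
      ≈⟨ solve 4 (λ x y f i → x :* (y :* f) :* i := (x :* y) :* (f :* i))
           ≈-refl x y [ j ]q! [ suc j ]q ⟩
    (x *ₚ y) *ₚ [ suc j ]q!
      ≈⟨ ℤ[q].*-congʳ {[ suc j ]q!} (q^-+ (suc s) (j * (j + suc (suc s))) (exponent-suc s j)) ⟨
    q ^ₚ (suc j * (suc j + s)) *ₚ [ suc j ]q!    ∎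
    where
    open SetoidReasoning setoid
    w = weight (suc (suc s)) j zero
    x = q ^ₚ suc s
    y = q ^ₚ (j * (j + suc (suc s)))
  weight-closed s (suc k) zero rewrite ℕ.+-identityʳ k = begin
    (w +ₚ x *ₚ w₀) *ₚ (([ k ]q! *ₚ [ suc k ]q) *ₚ 1ₚ)
      -- On the diagonal the double-step summand asks for k + 1 single steps out of k, hence
      -- vanishes.
      ≈⟨ ℤ[q].*-congʳ {([ k ]q! *ₚ [ suc k ]q) *ₚ 1ₚ} (ℤ[q].+-congˡ {w}
           (ℤ[q].*-congˡ {x} (weight-zero (suc (suc s)) (ℕ.n<1+n k)))) ⟩
    (w +ₚ x *ₚ 0ₚ) *ₚ (([ k ]q! *ₚ [ suc k ]q) *ₚ 1ₚ)
      ≈⟨ solve 4 (λ w x f i → (w :+ x :* con 0) :* ((f :* i) :* con 1) := w :* (f :* con 1) :* i)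
           ≈-refl w x [ k ]q! [ suc k ]q ⟩
    w *ₚ ([ k ]q! *ₚ 1ₚ) *ₚ [ suc k ]q
      ≈⟨ ℤ[q].*-congʳ {[ suc k ]q}
           (subst (λ n → weight (suc s) n k *ₚ ([ k ]q! *ₚ 1ₚ) ≈ 1ₚ *ₚ [ n ]q!)
             (ℕ.+-identityʳ k) (weight-closed (suc s) k zero)) ⟩
    1ₚ *ₚ [ k ]q! *ₚ [ suc k ]q
      ≈⟨ ℤ[q].*-assoc 1ₚ [ k ]q! [ suc k ]q ⟩
    1ₚ *ₚ [ suc k ]q!    ∎
    where
    open SetoidReasoning setoid
    w  = weight (suc s) k k
    w₀ = weight (suc (suc s)) k (suc k)
    x  = q ^ₚ suc s
  weight-closed s (suc k) (suc j) = begin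
    (w₁ +ₚ x *ₚ w₂) *ₚ (([ k ]q! *ₚ i) *ₚ ([ j ]q! *ₚ i′))
      ≈⟨ solve 7 (λ w₁ w₂ x f i f′ i′ → (w₁ :+ x :* w₂) :* ((f :* i) :* (f′ :* i′))
             := w₁ :* (f :* (f′ :* i′)) :* i :+ x :* (w₂ :* ((f :* i) :* f′)) :* i′)
           ≈-refl w₁ w₂ x [ k ]q! i [ j ]q! i′ ⟩
    w₁ *ₚ ([ k ]q! *ₚ [ suc j ]q!) *ₚ i +ₚ x *ₚ (w₂ *ₚ ([ suc k ]q! *ₚ [ j ]q!)) *ₚ i′
      -- The induction lowers k in the first summand and j in the second. The first yields `y *ₚ E`;
      -- the second yields `z`, which joins `x` to form `E` below.
      ≈⟨ ℤ[q].+-cong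
           (ℤ[q].*-congʳ {i} (≈-trans (weight-closed (suc s) k (suc j))
             (ℤ[q].*-congʳ {N} (q^-+ (suc j) (suc j * (suc j + s)) (exponent-shift s j)))))
           (ℤ[q].*-congʳ {i′} (ℤ[q].*-congˡ {x}
             (subst (λ n → weight (suc (suc s)) n (suc k) *ₚ ([ suc k ]q! *ₚ [ j ]q!) ≈ z *ₚ [ n ]q!)
               (≡.sym (ℕ.+-suc k j)) (weight-closed (suc (suc s)) (suc k) j)))) ⟩
    (y *ₚ E) *ₚ N *ₚ i +ₚ x *ₚ (z *ₚ N) *ₚ i′
      ≈⟨ solve 7 (λ x y z E N i i′ → (y :* E) :* N :* i :+ x :* (z :* N) :* i′
                                  := E :* N :* (y :* i) :+ (x :* z) :* N :* i′)
           ≈-refl x y z E N i i′ ⟩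
    E *ₚ N *ₚ (y *ₚ i) +ₚ (x *ₚ z) *ₚ N *ₚ i′
      ≈⟨ ℤ[q].+-congˡ {E *ₚ N *ₚ (y *ₚ i)} (ℤ[q].*-congʳ {i′} (ℤ[q].*-congʳ {N}
           (q^-+ (suc s) (j * (j + suc (suc s))) (exponent-suc s j)))) ⟨
    E *ₚ N *ₚ (y *ₚ i) +ₚ E *ₚ N *ₚ i′
      ≈⟨ solve 5 (λ E N y i i′ → E :* N :* (y :* i) :+ E :* N :* i′ := E :* (N :* (i′ :+ y :* i)))
           ≈-refl E N y i i′ ⟩
    E *ₚ (N *ₚ (i′ +ₚ y *ₚ i))
      -- The two q-integers left over combine into the last factor of the q-factorial of k + j + 2.
      ≈⟨ ℤ[q].*-congˡ {E} (ℤ[q].*-congˡ {N} (≈-trans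
           (≈-sym ([]q-+ (suc j) (suc k)))
           (ℤ[q].reflexive (cong [_]q (ℕ.+-comm (suc j) (suc k)))))) ⟩
    E *ₚ (N *ₚ [ suc k + suc j ]q)    ∎
    where
    open SetoidReasoning setoid
    w₁ = weight (suc s) (k + suc j) k
    w₂ = weight (suc (suc s)) (k + suc j) (suc k)
    x  = q ^ₚ suc s
    y  = q ^ₚ suc j
    z  = q ^ₚ (j * (j + suc (suc s)))
    i  = [ suc k ]q
    i′ = [ suc j ]q
    E  = q ^ₚ (suc j * (suc j + s))
    N  = [ k + suc j ]q!

  weight-closed-∸ : ∀ {n k} → k ≤ n →
    weight 0 n k *ₚ ([ k ]q! *ₚ [ n ∸ k ]q!) ≈ q ^ₚ ((n ∸ k) ^ 2) *ₚ [ n ]q!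
  weight-closed-∸ {n} {k} k≤n =
    subst (λ e → weight 0 n k *ₚ ([ k ]q! *ₚ [ n ∸ k ]q!) ≈ q ^ₚ e *ₚ [ n ]q!)
      -- The square unfolds to `(n ∸ k) * ((n ∸ k) * 1)`, so only the second factor has to be
      -- matched.
      (cong ((n ∸ k) *_) (≡.trans (ℕ.+-identityʳ (n ∸ k)) (≡.sym (ℕ.*-identityʳ (n ∸ k)))))
      (subst (λ l → weight 0 l k *ₚ ([ k ]q! *ₚ [ n ∸ k ]q!)
                      ≈ q ^ₚ ((n ∸ k) * ((n ∸ k) + 0)) *ₚ [ l ]q!)
        (ℕ.m+[n∸m]≡n k≤n) (weight-closed 0 k (n ∸ k)))

  expansionTerm : ℕ → ℕ → Poly
  expansionTerm n k = αs 0 k *ₚ weight 0 n k *ₚ continuant (2 * n ∸ k) k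

  summand≃expansionTerm : ∀ {n k} → k ≤ n →
    ι (const (a ^ ξ k)) *ᶠ ι (q ^ₚ ((n ∸ k) ^ 2)) *ᶠ qBinomial n k
      *ᶠ ι (const ((a * b) ^ ⌊ k /2⌋)) *ᶠ ι (shiftedF a b (2 * n ∸ k) k)
    ≃ ι (expansionTerm n k)
  summand≃expansionTerm {n} {k} k≤n = mk≃ (begin
    x *ₚ y *ₚ N *ₚ z *ₚ u *ₚ 1ₚ
      ≈⟨ solve 5 (λ x y N z u → x :* y :* N :* z :* u :* con 1 := x :* z :* (y :* N) :* u)
           ≈-refl x y N z u ⟩
    x *ₚ z *ₚ (y *ₚ N) *ₚ u
      -- The power of q times the numerator `N` is exchanged for the weight times `D`, the
      -- denominator of the q-binomial.
      ≈⟨ ℤ[q].*-cong (ℤ[q].*-cong (αs-closed k) (weight-closed-∸ k≤n))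
                     (ℤ[q].reflexive (≡.sym (shiftedF≡continuant (2 * n ∸ k) k))) ⟨
    αs 0 k *ₚ (w *ₚ D) *ₚ v
      ≈⟨ solve 4 (λ A w D v → A :* (w :* D) :* v
                           := A :* w :* v :* (con 1 :* con 1 :* D :* con 1 :* con 1))
           ≈-refl (αs 0 k) w D v ⟩
    αs 0 k *ₚ w *ₚ v *ₚ (1ₚ *ₚ 1ₚ *ₚ D *ₚ 1ₚ *ₚ 1ₚ)    ∎)
    where
    open SetoidReasoning setoid
    x = const (a ^ ξ k)
    y = q ^ₚ ((n ∸ k) ^ 2)
    z = const ((a * b) ^ ⌊ k /2⌋)
    u = shiftedF a b (2 * n ∸ k) k
    v = continuant (2 * n ∸ k) k
    w = weight 0 n k
    D = [ k ]q! *ₚ [ n ∸ k ]q!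
    N = [ n ]q!

  F≈sum-expansionTerm : ∀ n →
    F a b (2 * n) ≈ sum {n} (λ i → expansionTerm n (suc (toℕ i)))
  F≈sum-expansionTerm n = begin
    F a b (2 * n)
      ≡⟨ F≡continuant (2 * n) ⟩
    continuant 0 (2 * n)
      -- Two unfoldings of `alternate` swap a and b back, so its period holds by `refl`; here T is
      -- 2n. The term k = 0 then drops out because its continuant has length 0.
      ≈⟨ continuant-expansion (λ _ → refl) n 0 0 refl ⟩
    αs 0 0 *ₚ weight 0 n 0 *ₚ 0ₚ +ₚ tail
      ≈⟨ ℤ[q].+-congʳ {tail} (ℤ[q].zeroʳ (αs 0 0 *ₚ weight 0 n 0)) ⟩
    tail    ∎
    where
    open SetoidReasoning setoid
    tail = sum {n} (λ i → expansionTerm n (suc (toℕ i)))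

theorem16 : (a b : ℕ) .{{_ : NonZero a}} .{{_ : NonZero b}} (n : ℕ) →
    ι (F a b (2 * n)) ≃
    (∑[1≤ k ≤ n ]
    (ι (const (a ^ ξ k)) *ᶠ ι (q ^ₚ ((n ∸ k) ^ 2)) *ᶠ qBinomial n k
    *ᶠ ι (const ((a * b) ^ ⌊ k /2⌋)) *ᶠ ι (shiftedF a b (2 * n ∸ k) k)))
theorem16 a b n =
  ι-≃ (F≈sum-expansionTerm a b n)
      -- `k < n` is by definition `suc k ≤ n`, the range in which `n ∸ suc k` is true subtraction.
      (∑₁-≃-ι n (λ k → expansionTerm a b n (suc k)) λ k k<n → summand≃expansionTerm a b k<n)
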